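{- AC is a decision procedure for $\mathrm{CSP}_{\overline{SP}}(\mathrm{BTI})$.
   Context: Patterns. A pattern is a tuple $\langle X,D,A,\mathrm{cpt},<_X,<_D\rangle$ where $X$ is a finite set of variables; $D$ is a finite set of values; $A\subseteq X\times D$ is the set of points, with $D(x)=\{a\in D\mid \langle x,a\rangle\in A\}$ non-empty for every $x\in X$; $\mathrm{cpt}$ is a partial function from the set of unordered pairs of points $\{\langle x,a\rangle,\langle y,b\rangle\}$ with $x\neq y$ to $\{\mathrm{TRUE},\mathrm{FALSE}\}$; $<_X$ and $<_D$ are (possibly partial, possibly empty) strict orders on $X$ and $D$. Pairs of points with $\mathrm{cpt}=\mathrm{TRUE}$ (FALSE) are called positive (negative) edges. Instances. A (binary CSP) instance is a pattern $\langle X,D,A,\mathrm{cpt}\rangle$ without orders, with $\mathrm{cpt}$ total on all unordered pairs of points belonging to distinct variables. $R_{x,y}=\{\langle a,b\rangle\in D(x)\times D(y)\mid \mathrm{cpt}(\langle x,a\rangle,\langle y,b\rangle)=\mathrm{TRUE}\}$. A solution is a map $s:X\to D$ with $s(x)\in D(x)$ and $\langle s(x),s(y)\rangle\in R_{x,y}$ for all $x\neq y$. Occurrence. A homomorphism from $P'=\langle X',D',A',\mathrm{cpt}',<_{X'},<_{D'}\rangle$ to $P=\langle X,D,A,\mathrm{cpt},<_X,<_D\rangle$ is a (not necessarily injective) map $f:A'\to A$ such that: if $\mathrm{cpt}'(p,q)$ is defined then $\mathrm{cpt}(f(p),f(q))=\mathrm{cpt}'(p,q)$; the map $f_{var}:X'\to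 X$ given by $f_{var}(x')=x$ if $f(\langle x',a'\rangle)=\langle x,a\rangle$ for some $a',a$ is well-defined and injective; $x'<_{X'}y'$ implies $f_{var}(x')<_X f_{var}(y')$; and if $a',b'\in D'(x')$, $a'<_{D'}b'$, $f(\langle x',a'\rangle)=\langle x,a\rangle$, $f(\langle x',b'\rangle)=\langle x,b\rangle$, then $a<_D b$. A pattern $P$ occurs in an instance $I$ if for every pair of total orders on the variables and on the values of $I$ there is a homomorphism from $P$ to $I$ equipped with these orders. $\mathrm{CSP}_{\overline{SP}}(P)$ is the set of instances in which $P$ does not occur (i.e. instances for which there exist total orders on the variables and on the values such that $P$ has no homomorphism to the instance equipped with them). Arc consistency. A point $\langle x,a\rangle$ of an instance is arc consistent if for every variable $y\neq x$ there is a point $\langle y,b\rangle$ compatible with it ($\mathrm{cpt}=\mathrm{TRUE}$). Establishing arc consistency means repeatedly removing points that are not arc consistent. AC is a decision procedure for a class of instances if for every instance of the class, non-emptiness of all domains after establishing arc consistency guarantees that the instance has a solution. The pattern $\mathrm{BTI}$: variables $x,y,z$ with pairwise disjoint domains $D(x)=\{\epsilon\}$, $D(y)=\{\alpha,\beta\}$, $D(z)=\{\gamma,\delta\}$ (each value stands for its point); negative edges $\alpha\gamma$, $\epsilon\delta$; positive edges $\alpha\delta$, $\beta\gamma$, $\alpha\epsilon$, $\epsilon\gamma$; no other pair of points has defined compatibility; variable order $x<z$; domain order $\alpha>\beta$. -}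

module Defs where

open import Level using (0ℓ) renaming (suc to lsuc)
open import Data.Bool.Base using (Bool; true; false)
open import Data.Bool.Properties using () renaming (_≟_ to _≟ᵇ_)
open import Data.Fin.Base using (Fin)
open import Data.Fin.Patterns using (0F; 1F; 2F; 3F; 4F)
open import Data.Fin.Properties using (all?)
open import Data.Fin.Subset using (Subset; Nonempty; _∈_; _∪_; ⁅_⁆; _-_)
open import Data.Fin.Subset.Properties using (_∈?_)
open import Data.Maybe using (Maybe; just; nothing; Is-just; _<∣>_)
open import Data.Maybe.Properties using (≡-dec)
open import Data.Nat.Base using (ℕ)
open import Data.Product.Base using (Σ-syntax; ∃-syntax; _×_; _,_; proj₁; proj₂)
open import Data.Vec.Functional using (updateAt)
open import Function.Definitions using (Injective)
open import Relation.Binary.Construct.Closure.ReflexiveTransitive using (Star)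
open import Relation.Binary.Core using (Rel)
open import Relation.Binary.PropositionalEquality
  using (_≡_; _≢_; refl; isEquivalence; resp₂)
open import Relation.Binary.Structures using (IsStrictPartialOrder; IsStrictTotalOrder)
open import Relation.Nullary using (¬_)
open import Relation.Nullary.Decidable using (toWitness; _→-dec_)
open import Relation.Unary using (Pred)

-- The finite sets of variables and of values are represented by Fin n and Fin d.
record UnorderedPattern : Set where
  field
    n d : ℕ

  Var : Set
  Var = Fin n

  Val : Set
  Val = Fin d

  field
    dom          : Var → Subset d
    dom-nonempty : ∀ x → Nonempty (dom x)

  -- Membership in a Subset has at most one proof, so this is a set of pairs.
  Point : Set
  Point = Σ[ x ∈ Var ] Σ[ a ∈ Val ] a ∈ dom x

  var : Point → Var
  var = proj₁

  val : Point → Val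
  val p = proj₁ (proj₂ p)

  -- `nothing` means undefined; being a partial function on unordered pairs of
  -- points of distinct variables is expressed by the last two fields.
  field
    cpt          : Point → Point → Maybe Bool
    cpt-sym      : ∀ p q → cpt p q ≡ cpt q p
    cpt-distinct : ∀ p q → var p ≡ var q → cpt p q ≡ nothing

record Pattern : Set₁ where
  field
    unordered : UnorderedPattern

  open UnorderedPattern unordered public

  field
    _<X_        : Rel Var 0ℓ
    _<D_        : Rel Val 0ℓ
    <X-isStrict : IsStrictPartialOrder _≡_ _<X_
    <D-isStrict : IsStrictPartialOrder _≡_ _<D_

record Instance : Set where
  field
    unordered : UnorderedPattern

  open UnorderedPattern unordered public

  field
    cpt-total : ∀ p q → var p ≢ var q → Is-just (cpt p q)

  R : (x y : Var) → Rel Val 0ℓ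
  R x y a b = Σ[ a∈ ∈ a ∈ dom x ] Σ[ b∈ ∈ b ∈ dom y ]
                cpt (x , a , a∈) (y , b , b∈) ≡ just true

record Solution (I : Instance) : Set where
  open Instance I
  field
    assign     : Var → Val
    assign∈dom : ∀ x → assign x ∈ dom x
    compatible : ∀ x y → x ≢ y → R x y (assign x) (assign y)

record Homomorphism (P′ P : Pattern) : Set where
  private
    module P′ = Pattern P′
    module P  = Pattern P
  field
    f          : P′.Point → P.Point
    cpt-pres   : ∀ p q c → P′.cpt p q ≡ just c → P.cpt (f p) (f q) ≡ just c
    -- As all domains of P′ are non-empty, f determines f-var.
    f-var      : P′.Var → P.Var
    var-f      : ∀ p → P.var (f p) ≡ f-var (P′.var p)
    f-var-inj  : Injective _≡_ _≡_ f-var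
    <X-pres    : ∀ x y → x P′.<X y → f-var x P.<X f-var y
    <D-pres    : ∀ p q → P′.var p ≡ P′.var q → P′.val p P′.<D P′.val q →
                 P.val (f p) P.<D P.val (f q)

record TotalOrders (I : Instance) : Set₁ where
  open Instance I
  field
    _<X_       : Rel Var 0ℓ
    _<D_       : Rel Val 0ℓ
    <X-isTotal : IsStrictTotalOrder _≡_ _<X_
    <D-isTotal : IsStrictTotalOrder _≡_ _<D_

equip : (I : Instance) → TotalOrders I → Pattern
equip I O = record
  { unordered   = Instance.unordered I
  ; _<X_        = _<X_
  ; _<D_        = _<D_
  ; <X-isStrict = IsStrictTotalOrder.isStrictPartialOrder <X-isTotal
  ; <D-isStrict = IsStrictTotalOrder.isStrictPartialOrder <D-isTotal
  }
  where open TotalOrders O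

-- The instances in which P does not occur. P occurs in I if for every choice of
-- total orders there is a homomorphism from P to I equipped with them; its
-- negation is taken in the positive form, with the orders as a witness.
CSP-SP : Pattern → Pred Instance (lsuc 0ℓ)
CSP-SP P I = Σ[ O ∈ TotalOrders I ] ¬ Homomorphism P (equip I O)

module _ (I : Instance) where
  open Instance I

  -- The points remaining after some removals, as a family of domains.
  Domains : Set
  Domains = Var → Subset d

  ArcConsistentPoint : Domains → Var → Val → Set
  ArcConsistentPoint S x a = ∀ y → y ≢ x → ∃[ b ] (b ∈ S y × R x y a b)

  data _⟶_ (S : Domains) : Domains → Set where
    remove : ∀ x a → a ∈ S x → ¬ ArcConsistentPoint S x a →
             S ⟶ updateAt S x (_- a)

  ArcConsistent : Domains → Set
  ArcConsistent S = ∀ x a → a ∈ S x → ArcConsistentPoint S x a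

  -- S is a result of establishing arc consistency in I.
  EstablishesAC : Domains → Set
  EstablishesAC S = Star _⟶_ dom S × ArcConsistent S

ACDecides : ∀ {ℓ} → Pred Instance ℓ → Set ℓ
ACDecides C = ∀ I → C I → ∀ S → EstablishesAC I S → (∀ x → Nonempty (S x)) →
              Solution I

module BTI-definition where

  pattern x = 0F
  pattern y = 1F
  pattern z = 2F

  pattern α = 0F
  pattern β = 1F
  pattern γ = 2F
  pattern δ = 3F
  pattern ε = 4F

  dom : Fin 3 → Subset 5
  dom x = ⁅ ε ⁆
  dom y = ⁅ α ⁆ ∪ ⁅ β ⁆
  dom z = ⁅ γ ⁆ ∪ ⁅ δ ⁆

  dom-nonempty : ∀ v → Nonempty (dom v)
  dom-nonempty x = ε , toWitness {a? = ε ∈? dom x} _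
  dom-nonempty y = α , toWitness {a? = α ∈? dom y} _
  dom-nonempty z = γ , toWitness {a? = γ ∈? dom z} _

  -- Each edge in one orientation. The domains are pairwise disjoint, so a value
  -- determines its point.
  edge : Fin 5 → Fin 5 → Maybe Bool
  edge α γ = just false
  edge ε δ = just false
  edge α δ = just true
  edge β γ = just true
  edge α ε = just true
  edge ε γ = just true
  edge _ _ = nothing

  cptVal : Fin 5 → Fin 5 → Maybe Bool
  cptVal a b = edge a b <∣> edge b a

  cptVal-sym : ∀ a b → cptVal a b ≡ cptVal b a
  cptVal-sym = toWitness
    {a? = all? λ a → all? λ b → ≡-dec _≟ᵇ_ (cptVal a b) (cptVal b a)} _

  cptVal-distinct : ∀ v a b → a ∈ dom v → b ∈ dom v → cptVal a b ≡ nothing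
  cptVal-distinct = toWitness
    {a? = all? λ v → all? λ a → all? λ b → (a ∈? dom v) →-dec
          ((b ∈? dom v) →-dec ≡-dec _≟ᵇ_ (cptVal a b) nothing)} _

  data _<X_ : Rel (Fin 3) 0ℓ where
    x<z : x <X z

  data _<D_ : Rel (Fin 5) 0ℓ where
    β<α : β <D α

  BTI : Pattern
  BTI = record
    { unordered = record
      { n            = 3
      ; d            = 5
      ; dom          = dom
      ; dom-nonempty = dom-nonempty
      ; cpt          = λ (_ , a , _) (_ , b , _) → cptVal a b
      ; cpt-sym      = λ (_ , a , _) (_ , b , _) → cptVal-sym a b
      ; cpt-distinct = λ { (v , a , a∈) (_ , b , b∈) refl →
                           cptVal-distinct v a b a∈ b∈ }
      }
    ; _<X_        = _<X_
    ; _<D_        = _<D_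
    ; <X-isStrict = record
      { isEquivalence = isEquivalence
      ; irrefl        = λ { refl () }
      ; trans         = λ { x<z () }
      ; <-resp-≈      = resp₂ _<X_
      }
    ; <D-isStrict = record
      { isEquivalence = isEquivalence
      ; irrefl        = λ { refl () }
      ; trans         = λ { β<α () }
      ; <-resp-≈      = resp₂ _<D_
      }
    }

open BTI-definition public using (BTI)

{-# OPTIONS --safe #-}

-- Assign the variables in increasing order, giving each of them the largest
-- remaining value compatible with all earlier choices.  This never gets stuck.
-- Call a value live if it is compatible with all choices made so far.  Avoiding
-- BTI makes "having a live support at x" upward closed among the live values of
-- z, so it suffices that some pair of live values at x < z is compatible.
-- Suppose that none is, and let e and n be live at x and z.
--   * BTI with an earlier variable, z and x shows that no support of e at z is
--     smaller than n.
--   * At the last stage where e still had a live support c at z, BTI with x, the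
--     variable assigned at that stage, and z shows that c has no live support at
--     that variable; as n has one, c is smaller than n.
module Submission where

open import Defs
open import Data.Bool.Base using (Bool; true; false)
open import Data.Bool.Properties using () renaming (_≟_ to _≟ᵇ_)
open import Data.Empty using (⊥)
open import Data.Fin.Base using (Fin)
open import Data.Fin.Patterns using (0F; 1F; 2F; 3F; 4F)
open import Data.Fin.Properties using (_≟_; all?; any?)
open import Data.Fin.Subset using (Nonempty; _∈_; ⁅_⁆)
open import Data.Fin.Subset.Properties using (_∈?_; p─q⊆p)
open import Data.List.Base using (List; []; _∷_; filter; allFin)
import Data.List.Extrema
open import Data.List.Membership.Propositional using () renaming (_∈_ to _∈ˡ_)
open import Data.List.Membership.Propositional.Properties using (∈-allFin; ∈-filter⁺)
import Data.List.Membership.DecPropositional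
import Data.List.Sort
open import Data.List.Relation.Binary.Permutation.Propositional using (↭-sym; ↭⇒↭ₛ)
open import Data.List.Relation.Binary.Permutation.Propositional.Properties using (∈-resp-↭)
open import Data.List.Relation.Binary.Permutation.Setoid.Properties using (Unique-resp-↭)
open import Data.List.Relation.Unary.All as All using (All; []; _∷_)
open import Data.List.Relation.Unary.All.Properties using (¬All⇒Any¬; all-filter)
open import Data.List.Relation.Unary.AllPairs as AllPairs using (AllPairs; []; _∷_)
open import Data.List.Relation.Unary.Any using (Any; here; there)
open import Data.List.Relation.Unary.Sorted.TotalOrder.Properties using (Sorted⇒AllPairs)
open import Data.List.Relation.Unary.Unique.Propositional.Properties using (allFin⁺)
open import Data.Maybe.Base using (just; nothing)
open import Data.Maybe.Properties using (≡-dec)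
import Data.Maybe.Relation.Unary.All as Maybe
open import Data.Product.Base using (∃-syntax; _×_; _,_; proj₁; proj₂)
open import Data.Product.Properties using () renaming (≡-dec to ×-≡-dec)
open import Data.Sum.Base using (_⊎_; inj₁; inj₂)
open import Data.Vec.Functional.Properties using (updateAt-updates; updateAt-minimal)
open import Data.Vec.Properties.WithK using ([]=-irrelevant)
open import Function.Base using (_∘_; flip)
open import Relation.Binary.Bundles using (StrictTotalOrder)
import Relation.Binary.Construct.Flip.EqAndOrd as Flip
open import Relation.Binary.Construct.Closure.ReflexiveTransitive using (Star; _◅_)
  renaming (ε to done)
open import Relation.Binary.Core using (Rel)
open import Relation.Binary.Definitions using (tri<; tri≈; tri>)
import Relation.Binary.Properties.StrictTotalOrder as STO
open import Relation.Binary.PropositionalEquality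
  using (_≡_; _≢_; refl; sym; trans; cong; subst; ≢-sym)
import Relation.Binary.PropositionalEquality.Properties as ≡
open import Relation.Binary.Structures using (IsStrictTotalOrder)
open import Relation.Nullary using (¬_; Dec; yes; no; contradiction)
open import Relation.Nullary.Decidable using (toWitness; map′; _×-dec_; _→-dec_)
open import Relation.Unary using (Pred; Decidable)

-- Maxima and descending enumerations in a finite strict total order.

module _ {ℓ n} {_<_ : Rel (Fin n) ℓ} (isSTO : IsStrictTotalOrder _≡_ _<_) where

  private
    sto : StrictTotalOrder _ _ _
    sto = record { isStrictTotalOrder = isSTO }

  maximum : ∀ {p} {P : Pred (Fin n) p} → Decidable P → ∃[ a ] P a →
            ∃[ m ] P m × (∀ b → P b → b < m ⊎ b ≡ m)
  maximum {P = P} P? (a , pa) =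
    max a candidates , argmax-all (λ b → b) pa (all-filter P? (allFin n)) ,
    λ b pb → All.lookup (xs≤max a candidates) (∈-filter⁺ P? (∈-allFin b) pb)
    where
    open Data.List.Extrema (STO.totalOrder sto)
    candidates = filter P? (allFin n)

  descendingList : ∃[ xs ] AllPairs (flip _<_) xs × (∀ x → x ∈ˡ xs)
  descendingList =
    sort (allFin n) ,
    -- Sorting yields weak inequalities only; distinctness of the entries makes them strict.
    AllPairs.zipWith strict
      ( Sorted⇒AllPairs (STO.totalOrder stoᵒᵖ) (sort-↗ (allFin n))
      , Unique-resp-↭ (≡.setoid _) (↭⇒↭ₛ (↭-sym (sort-↭ (allFin n)))) (allFin⁺ n)) ,
    λ x → ∈-resp-↭ (↭-sym (sort-↭ (allFin n))) (∈-allFin x)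
    where
    stoᵒᵖ = Flip.strictTotalOrder sto
    open Data.List.Sort (STO.decTotalOrder stoᵒᵖ)
    strict : ∀ {x y} → (y < x ⊎ x ≡ y) × x ≢ y → y < x
    strict (inj₁ y<x , _)   = y<x
    strict (inj₂ x≡y , x≢y) = contradiction x≡y x≢y

-- The edges of BTI.

module _ where
  open BTI-definition

  owner : Fin 5 → Fin 3
  owner α = y
  owner β = y
  owner γ = z
  owner δ = z
  owner ε = x

  owner-dom : ∀ v a → a ∈ dom v → owner a ≡ v
  owner-dom = toWitness
    {a? = all? λ v → all? λ a → (a ∈? dom v) →-dec (owner a ≟ v)} _

  -- With the edges as data, preservation of compatibility reduces to six checks instead of one per
  -- pair of values.
  edges : List (Fin 5 × Fin 5 × Bool)
  edges = (α , γ , false) ∷ (ε , δ , false) ∷ (α , δ , true) ∷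
          (β , γ , true) ∷ (α , ε , true) ∷ (ε , γ , true) ∷ []

  edge-listed : ∀ a b → Maybe.All (λ c → (a , b , c) ∈ˡ edges) (edge a b)
  edge-listed = toWitness
    {a? = all? λ a → all? λ b → Maybe.dec (λ c → (a , b , c) ∈ˡ? edges) (edge a b)} _
    where open Data.List.Membership.DecPropositional (×-≡-dec _≟_ (×-≡-dec _≟_ _≟ᵇ_))
            renaming (_∈?_ to _∈ˡ?_)

  cptVal-edge : ∀ a b {c} → cptVal a b ≡ just c →
                (a , b , c) ∈ˡ edges ⊎ (b , a , c) ∈ˡ edges
  cptVal-edge a b eq with edge a b | edge-listed a b
  cptVal-edge a b refl | just _  | Maybe.just ab∈ = inj₁ ab∈
  cptVal-edge a b eq   | nothing | _ with edge b a | edge-listed b a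
  cptVal-edge a b refl | nothing | _ | just _ | Maybe.just ba∈ = inj₂ ba∈

-- Compatibility and removals in an instance.

module _ (I : Instance) where
  open Instance I

  R-sym : ∀ {x y a b} → R x y a b → R y x b a
  R-sym (a∈ , b∈ , eq) = b∈ , a∈ , trans (cpt-sym _ _) eq

  R? : ∀ x y a b → Dec (R x y a b)
  R? x y a b with a ∈? dom x | b ∈? dom y
  ... | no a∉  | _      = no (a∉ ∘ proj₁)
  ... | yes _  | no b∉  = no (b∉ ∘ proj₁ ∘ proj₂)
  ... | yes a∈ | yes b∈ = map′ (λ eq → a∈ , b∈ , eq)
    -- `R` carries its own membership proofs; by their uniqueness they may be replaced by those just
    -- computed.
    (λ { (a∈′ , b∈′ , eq) → subst (λ p → cpt (x , a , p) (y , b , b∈) ≡ just true)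
          ([]=-irrelevant a∈′ a∈)
          (subst (λ q → cpt (x , a , a∈′) (y , b , q) ≡ just true)
            ([]=-irrelevant b∈′ b∈) eq) })
    (≡-dec _≟ᵇ_ (cpt (x , a , a∈) (y , b , b∈)) (just true))

  ¬R⇒false : ∀ {x y a b} → x ≢ y → (a∈ : a ∈ dom x) (b∈ : b ∈ dom y) →
             ¬ R x y a b → cpt (x , a , a∈) (y , b , b∈) ≡ just false
  ¬R⇒false x≢y a∈ b∈ ¬r
    with cpt (_ , _ , a∈) (_ , _ , b∈) in eq | cpt-total (_ , _ , a∈) (_ , _ , b∈) x≢y
  ... | just true  | _ = contradiction (a∈ , b∈ , eq) ¬r
  ... | just false | _ = refl

  R⇒true : ∀ {x y a b} (a∈ : a ∈ dom x) (b∈ : b ∈ dom y) →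
           R x y a b → cpt (x , a , a∈) (y , b , b∈) ≡ just true
  R⇒true a∈ b∈ (a∈′ , b∈′ , eq)
    rewrite []=-irrelevant a∈ a∈′ | []=-irrelevant b∈ b∈′ = eq

  removal-⊆ : ∀ {S T x a} → Star (_⟶_ I) S T → a ∈ T x → a ∈ S x
  removal-⊆ done a∈ = a∈
  removal-⊆ {S} {x = x} (remove y b _ _ ◅ steps) a∈ with removal-⊆ steps a∈ | x ≟ y
  ... | a∈′ | yes refl = p─q⊆p (S x) ⁅ b ⁆ (subst (_ ∈_) (updateAt-updates x S) a∈′)
  ... | a∈′ | no x≢y   = subst (_ ∈_) (updateAt-minimal x y S x≢y) a∈′

-- Occurrences of BTI from six relations between values.

module _ (I : Instance) (O : TotalOrders I) where
  open Instance I
  open TotalOrders O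
  module B = BTI-definition

  module _
    {x y z : Var} (x≢y : x ≢ y) (y≢z : y ≢ z) (x≢z : x ≢ z) (x<z : x <X z)
    {α β γ δ ε : Val} (β<α : β <D α)
    (¬αγ : ¬ R y z α γ) (¬εδ : ¬ R x z ε δ) (αδ : R y z α δ)
    (βγ : R y z β γ) (αε : R y x α ε) (εγ : R x z ε γ)
    where

    private
      -- Every point of BTI lies on a positive edge, so the positive relations supply all
      -- memberships.
      α∈ = proj₁ αδ
      β∈ = proj₁ βγ
      γ∈ = proj₁ (proj₂ βγ)
      δ∈ = proj₁ (proj₂ αδ)
      ε∈ = proj₁ εγ

      point : Fin 5 → Point
      point B.α = y , α , α∈
      point B.β = y , β , β∈
      point B.γ = z , γ , γ∈
      point B.δ = z , δ , δ∈
      point B.ε = x , ε , ε∈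

      variable′ : Fin 3 → Var
      variable′ B.x = x
      variable′ B.y = y
      variable′ B.z = z

      var-point : ∀ a → var (point a) ≡ variable′ (owner a)
      var-point B.α = refl
      var-point B.β = refl
      var-point B.γ = refl
      var-point B.δ = refl
      var-point B.ε = refl

      injective : ∀ {u v} → variable′ u ≡ variable′ v → u ≡ v
      injective {B.x} {B.x} _  = refl
      injective {B.x} {B.y} eq = contradiction eq x≢y
      injective {B.x} {B.z} eq = contradiction eq x≢z
      injective {B.y} {B.x} eq = contradiction (sym eq) x≢y
      injective {B.y} {B.y} _  = refl
      injective {B.y} {B.z} eq = contradiction eq y≢z
      injective {B.z} {B.x} eq = contradiction (sym eq) x≢z
      injective {B.z} {B.y} eq = contradiction (sym eq) y≢z
      injective {B.z} {B.z} _  = refl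

      edges-preserved : All (λ (a , b , c) → cpt (point a) (point b) ≡ just c) edges
      edges-preserved =
        ¬R⇒false I y≢z α∈ γ∈ ¬αγ ∷ ¬R⇒false I x≢z ε∈ δ∈ ¬εδ ∷ R⇒true I α∈ δ∈ αδ ∷
        R⇒true I β∈ γ∈ βγ ∷ R⇒true I α∈ ε∈ αε ∷ R⇒true I ε∈ γ∈ εγ ∷ []

      preserved : ∀ a b c → B.cptVal a b ≡ just c → cpt (point a) (point b) ≡ just c
      preserved a b c eq with cptVal-edge a b eq
      ... | inj₁ ab∈ = All.lookup edges-preserved ab∈
      ... | inj₂ ba∈ = trans (cpt-sym _ _) (All.lookup edges-preserved ba∈)

    BTI-occurrence : Homomorphism BTI (equip I O)
    BTI-occurrence = record
      { f         = λ (_ , a , _) → point a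
      ; cpt-pres  = λ (_ , a , _) (_ , b , _) c → preserved a b c
      ; f-var     = variable′
      ; var-f     = λ (v , a , a∈) →
                      trans (var-point a) (cong variable′ (owner-dom v a a∈))
      ; f-var-inj = injective
      ; <X-pres   = λ { _ _ B.x<z → x<z }
      ; <D-pres   = λ { (_ , B.β , _) (_ , B.α , _) _ B.β<α → β<α }
      }

-- The greedy assignment.

module GreedyAssignment
  (I : Instance) (O : TotalOrders I) (avoids : ¬ Homomorphism BTI (equip I O))
  (S : Domains I) (S-ac : ArcConsistent I S) (S-nonempty : ∀ x → Nonempty (S x))
  where
  open Instance I
  open TotalOrders O
  module X = IsStrictTotalOrder <X-isTotal
  module D = IsStrictTotalOrder <D-isTotal

  <X⇒≢ : ∀ {x y} → x <X y → x ≢ y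
  <X⇒≢ x<y x≡y = X.irrefl x≡y x<y

  no-BTI : ∀ {x y z α β γ δ ε} → x ≢ y → y ≢ z → x <X z → β <D α →
           ¬ R y z α γ → ¬ R x z ε δ → R y z α δ → R y z β γ → R y x α ε →
           R x z ε γ → ⊥
  no-BTI x≢y y≢z x<z β<α ¬αγ ¬εδ αδ βγ αε εγ =
    avoids (BTI-occurrence I O x≢y y≢z (<X⇒≢ x<z) x<z β<α ¬αγ ¬εδ αδ βγ αε εγ)

  -- The most recent choice comes first, so the tails are the earlier stages.
  Partial : Set
  Partial = List (Var × Val)

  Live : Partial → Var → Val → Set
  Live t x a = a ∈ S x × All (λ (y , b) → R y x b a) t

  live? : ∀ t x → Decidable (Live t x)
  live? t x a = (a ∈? S x) ×-dec All.all? (λ (y , b) → R? I y x b a) t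

  _Before_ : Partial → Var → Set
  t Before x = All (λ (y , _) → y <X x) t

  Supported : Partial → Var → Var → Val → Set
  Supported t x z c = ∃[ a ] Live t x a × R x z a c

  supported? : ∀ t x z → Decidable (Supported t x z)
  supported? t x z c = any? λ a → live? t x a ×-dec R? I x z a c

  -- Induction over the stages. If the support `a` of `c` fails for `c′`, the support `a′` that `c′`
  -- had one stage earlier survives the choice `s` at `k`, or BTI occurs. Either of `x` and `z` may
  -- be the smaller variable; both cases are used below.
  supported-upward : ∀ t {x z c c′} → t Before x → t Before z → x ≢ z →
                     Live t z c → Live t z c′ → c <D c′ →
                     Supported t x z c → Supported t x z c′
  supported-upward [] _ _ x≢z _ (c′∈ , _) _ _ =
    let a , a∈ , r = S-ac _ _ c′∈ _ x≢z in a , (a∈ , []) , R-sym I r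
  supported-upward ((k , s) ∷ t) {x} {z} {c} {c′} (k<x ∷ t<x) (k<z ∷ t<z) x≢z
    (c∈ , _ ∷ tc) (c′∈ , kc′ ∷ tc′) c<c′ (a , (a∈ , ka ∷ ta) , ac)
    with R? I x z a c′
  ... | yes ac′ = a , (a∈ , ka ∷ ta) , ac′
  ... | no ¬ac′
    with supported-upward t t<x t<z x≢z (c∈ , tc) (c′∈ , tc′) c<c′ (a , (a∈ , ta) , ac)
  ... | a′ , (a′∈ , ta′) , a′c′ with R? I k x s a′
  ... | yes ka′ = a′ , (a′∈ , ka′ ∷ ta′) , a′c′
  -- BTI on `k`, `z`, `x` in the roles x, y, z, with α = `c′`, β = `c`, γ = `a`, δ = `a′`, ε = `s`.
  ... | no ¬ka′ = contradiction ka
    (no-BTI (<X⇒≢ k<z) (≢-sym x≢z) k<x c<c′ (¬ac′ ∘ R-sym I) ¬ka′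
      (R-sym I a′c′) (R-sym I ac) (R-sym I kc′))

  data Greedy : Partial → Set where
    []  : Greedy []
    _∷_ : ∀ {t k s} →
          t Before k × Live t k s × (∀ b → Live t k b → b <D s ⊎ b ≡ s) →
          Greedy t → Greedy ((k , s) ∷ t)

  -- Arc consistency gives `n` a support `d` at `x`. It is not live, so an earlier choice rejects
  -- it, and `c <D n` would complete a BTI.
  support-≮ : ∀ {t x z e n c} → t Before x → x <X z → Live t x e → Live t z n →
              ¬ Supported t x z n → R x z e c → ¬ c <D n
  support-≮ {t} {x} {z} {e} {n} {c} t<x x<z (e∈ , te) (n∈ , tn) ¬sup ec c<n =
    let d , d∈ , nd = S-ac z n n∈ x (<X⇒≢ x<z)
    in conflict t<x te tn (R-sym I nd)
         (¬All⇒Any¬ (λ (i , s) → R? I i x s d) t λ td → ¬sup (d , (d∈ , td) , R-sym I nd))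
    where
    conflict : ∀ {u d} → u Before x → All (λ (i , s) → R i x s e) u →
               All (λ (i , s) → R i z s n) u → R x z d n →
               Any (λ (i , s) → ¬ R i x s d) u → ⊥
    -- BTI on `i`, `z`, `x` in the roles x, y, z, with α = `n`, β = `c`, γ = `e`, δ = `d`, and ε the
    -- choice at `i`.
    conflict (i<x ∷ _) (ie ∷ _) (in′ ∷ _) dn (here ¬id) =
      no-BTI (<X⇒≢ (X.trans i<x x<z)) (≢-sym (<X⇒≢ x<z)) i<x c<n
        (λ ne → ¬sup (e , (e∈ , te) , R-sym I ne)) ¬id (R-sym I dn) (R-sym I ec)
        (R-sym I in′) ie
    conflict (_ ∷ u<x) (_ ∷ ue) (_ ∷ un) dn (there ¬ud) = conflict u<x ue un dn ¬ud

  -- Choices are undone until `e` regains a live support `c` at `z`, at the latest at the empty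
  -- stage by arc consistency. The choice `s` at `k` undone last rejects `c` but accepts `n`.
  smaller-support : ∀ {t x z e n} → Greedy t → t Before x → t Before z → x <X z →
                    Live t x e → Live t z n → ¬ Supported t z x e →
                    ∃[ c ] R x z e c × c <D n
  smaller-support {x = x} {z} {e} [] _ _ x<z (e∈ , _) _ ¬sup =
    let c , c∈ , ec = S-ac x e e∈ z (≢-sym (<X⇒≢ x<z))
    in contradiction (c , (c∈ , []) , R-sym I ec) ¬sup
  smaller-support {(k , s) ∷ t} {x} {z} {e} {n} ((t<k , s-live , s-max) ∷ g)
    (k<x ∷ t<x) (k<z ∷ t<z) x<z (e∈ , ke ∷ te) (n∈ , kn ∷ tn) ¬sup
    with supported? t z x e
  ... | no ¬sup′ = smaller-support g t<x t<z x<z (e∈ , te) (n∈ , tn) ¬sup′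
  ... | yes (c , (c∈ , tc) , ce) = c , R-sym I ce , c<n
    where
    ¬kc : ¬ R k z s c
    ¬kc kc = ¬sup (c , (c∈ , kc ∷ tc) , ce)
    ¬en : ¬ R x z e n
    ¬en en = ¬sup (n , (n∈ , kn ∷ tn) , R-sym I en)
    c-unsupported : ¬ Supported t k z c
    -- Maximality of `s` leaves `b <D s` or `b ≡ s`. The former gives BTI on `x`, `k`, `z` in the
    -- roles x, y, z, with α = `s`, β = `b`, γ = `c`, δ = `n`, ε = `e`.
    c-unsupported (b , b-live , bc) with s-max b b-live
    ... | inj₁ b<s  = no-BTI (≢-sym (<X⇒≢ k<x)) (<X⇒≢ k<z) x<z b<s
                        ¬kc ¬en kn bc ke (R-sym I ce)
    ... | inj₂ refl = ¬kc bc
    c<n : c <D n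
    c<n with D.compare c n
    ... | tri< c<n _ _  = c<n
    ... | tri≈ _ refl _ = contradiction kn ¬kc
    -- `s` supports `n`, and upward closure would pass a support on to `c`.
    ... | tri> _ _ n<c  = contradiction
      (supported-upward t t<k t<z (<X⇒≢ k<z) (n∈ , tn) (c∈ , tc) n<c (s , s-live , kn))
      c-unsupported

  -- If neither `n` nor `e` had a live support, some support of `e` would be both smaller and not
  -- smaller than `n`.
  live-edge : ∀ {t x z e n} → Greedy t → t Before x → t Before z → x <X z →
              Live t x e → Live t z n →
              ∃[ c ] Live t z c × Supported t x z c
  live-edge {t} {x} {z} {e} {n} g t<x t<z x<z e-live n-live
    with supported? t x z n | supported? t z x e
  ... | yes sup | _                      = n , n-live , sup
  ... | no _    | yes (c , c-live , ce)  = c , c-live , e , e-live , R-sym I ce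
  ... | no ¬n   | no ¬e                  =
    let c , ec , c<n = smaller-support g t<x t<z x<z e-live n-live ¬e
    in contradiction c<n (support-≮ t<x x<z e-live n-live ¬n ec)

  -- Before `k` is assigned, some live pair at `k` and `z` is compatible. Upward closure moves its
  -- end at `k` up to the maximum `s`, and the resulting support of `s` at `z` survives the choice.
  live-nonempty : ∀ {t z} → Greedy t → t Before z → ∃[ c ] Live t z c
  live-nonempty {z = z} [] [] = let c , c∈ = S-nonempty z in c , c∈ , []
  live-nonempty {(k , s) ∷ t} {z} ((t<k , s-live , s-max) ∷ g) (k<z ∷ t<z) =
    let n , n-live = live-nonempty g t<z
        c , c-live , b , b-live , bc = live-edge g t<k t<z k<z s-live n-live
        c′ , (c′∈ , tc′) , c′s = supports-s (s-max b b-live) b-live (c , c-live , R-sym I bc)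
    in c′ , c′∈ , R-sym I c′s ∷ tc′
    where
    supports-s : ∀ {b} → b <D s ⊎ b ≡ s → Live t k b → Supported t z k b →
                 Supported t z k s
    supports-s (inj₁ b<s) b-live =
      supported-upward t t<z t<k (≢-sym (<X⇒≢ k<z)) b-live s-live b<s
    supports-s (inj₂ refl) _ sup = sup

  -- The list descends, so the recursion assigns the smallest variable first. The last component
  -- carries the bound on the variables of `xs` over to those of `t`, as the next choice requires.
  greedy : ∀ {xs} → AllPairs (flip _<X_) xs →
           ∃[ t ] Greedy t × (∀ {x} → x ∈ˡ xs → ∃[ a ] (x , a) ∈ˡ t) ×
                  (∀ {x} → All (_<X x) xs → t Before x)
  greedy [] = [] , [] , (λ ()) , λ _ → []
  greedy {x ∷ _} (x> ∷ xs>) =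
    let t , g , covers , before = greedy xs>
        s , s-live , s-max = maximum <D-isTotal (live? t x) (live-nonempty g (before x>))
    in (x , s) ∷ t , (before x> , s-live , s-max) ∷ g ,
       (λ { (here refl) → s , here refl
          ; (there x∈)  → let a , a∈ = covers x∈ in a , there a∈ }) ,
       λ { (x<y ∷ xs<y) → x<y ∷ before xs<y }

  greedy-∈S : ∀ {t x a} → Greedy t → (x , a) ∈ˡ t → a ∈ S x
  greedy-∈S ((_ , (a∈ , _) , _) ∷ _) (here refl) = a∈
  greedy-∈S (_ ∷ g)                  (there xa∈) = greedy-∈S g xa∈

  -- Of two choices, the later one was live with respect to the earlier.
  greedy-compatible : ∀ {t x y a b} → Greedy t → x ≢ y →
                      (x , a) ∈ˡ t → (y , b) ∈ˡ t → R x y a b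
  greedy-compatible _ x≢y (here refl) (here refl) = contradiction refl x≢y
  greedy-compatible ((_ , (_ , ta) , _) ∷ _) _ (here refl) (there yb∈) =
    R-sym I (All.lookup ta yb∈)
  greedy-compatible ((_ , (_ , tb) , _) ∷ _) _ (there xa∈) (here refl) =
    All.lookup tb xa∈
  greedy-compatible (_ ∷ g) x≢y (there xa∈) (there yb∈) =
    greedy-compatible g x≢y xa∈ yb∈

theorem3p3 : ACDecides (CSP-SP BTI)
theorem3p3 I (O , avoids) S (removals , S-ac) S-nonempty =
  let xs , xs> , all∈ = descendingList (TotalOrders.<X-isTotal O)
      t , g , covers , _ = greedy xs>
  in record
    { assign     = λ x → proj₁ (covers (all∈ x))
    -- The values lie in `S`, and removals only shrink the domains.
    ; assign∈dom = λ x → removal-⊆ I removals (greedy-∈S g (proj₂ (covers (all∈ x))))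
    ; compatible = λ x y x≢y → greedy-compatible g x≢y
                     (proj₂ (covers (all∈ x))) (proj₂ (covers (all∈ y)))
    }
  where open GreedyAssignment I O avoids S S-ac S-nonempty
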